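{- Let $F_{1111}(n)$ be the number of zero-one matrices (of any size) with exactly $n$ ones and no zero row or zero column, and let $F_{1011}(n)$ be the number of those matrices which in addition have no two equal rows. Then $F_{1011}(n)=o(F_{1111}(n))$ as $n\to\infty$.
   Context: Matrices are counted as arrays: the order of rows and columns matters (no identification under row or column permutations). In $F_{1111}(n)$, repeated rows and columns are allowed; in $F_{1011}(n)$, repeated columns are allowed but repeated rows are forbidden. -}

module Defs where

open import Data.Bool using (Bool; true; false)
import Data.Bool as B
open import Data.Nat using (ℕ; zero; suc; _+_)
import Data.Nat as N
open import Data.List using (List; []; _∷_; map; concatMap; length; filter; upTo)
open import Data.Nat.ListAction using (sum)
open import Data.Vec using (Vec; []; _∷_; toList; transpose)
open import Data.Vec.Properties using (≡-dec)
open import Data.List.Relation.Unary.All using (All; all?)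
open import Data.List.Relation.Unary.Any using (Any; any?)
open import Data.List.Relation.Unary.Unique.Propositional using (Unique)
import Data.List.Relation.Unary.Unique.DecPropositional as UDec
open import Data.Product using (_×_; ∃)
open import Relation.Nullary using (Dec; _×-dec_)
open import Relation.Binary.PropositionalEquality using (_≡_)

Matrix : ℕ → ℕ → Set
Matrix m p = Vec (Vec Bool p) m

allVecs : (k : ℕ) → List (Vec Bool k)
allVecs zero = [] ∷ []
allVecs (suc k) = concatMap (λ v → (false ∷ v) ∷ (true ∷ v) ∷ []) (allVecs k)

allMatrices : (m p : ℕ) → List (Matrix m p)
allMatrices zero p = [] ∷ []
allMatrices (suc m) p = concatMap (λ r → map (r ∷_) (allMatrices m p)) (allVecs p)

onesVec : ∀ {k} → Vec Bool k → ℕ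
onesVec [] = zero
onesVec (true ∷ v) = suc (onesVec v)
onesVec (false ∷ v) = onesVec v

ones : ∀ {m p} → Matrix m p → ℕ
ones [] = zero
ones (r ∷ M) = onesVec r + ones M

NonZeroVec : ∀ {k} → Vec Bool k → Set
NonZeroVec v = Any (_≡ true) (toList v)

Valid1111 : ∀ {m p} → ℕ → Matrix m p → Set
Valid1111 n M = (ones M ≡ n) × (All NonZeroVec (toList M) × All NonZeroVec (toList (transpose M)))

Valid1011 : ∀ {m p} → ℕ → Matrix m p → Set
Valid1011 n M = Valid1111 n M × Unique (toList M)

nonZeroVec? : ∀ {k} (v : Vec Bool k) → Dec (NonZeroVec v)
nonZeroVec? v = any? (B._≟ true) (toList v)

valid1111? : ∀ {m p} (n : ℕ) (M : Matrix m p) → Dec (Valid1111 n M)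
valid1111? n M = (ones M N.≟ n) ×-dec (all? nonZeroVec? (toList M) ×-dec all? nonZeroVec? (toList (transpose M)))

valid1011? : ∀ {m p} (n : ℕ) (M : Matrix m p) → Dec (Valid1011 n M)
valid1011? {p = p} n M = valid1111? n M ×-dec UDec.unique? (≡-dec B._≟_) (toList M)

-- Sum over all sizes m, p ∈ {0,…,n}. A matrix with n ones and no zero row/column
-- has at most n rows and at most n columns, so this counts matrices of any size.
sumSizes : ℕ → (ℕ → ℕ → ℕ) → ℕ
sumSizes n f = sum (map (λ m → sum (map (λ p → f m p) (upTo (suc n)))) (upTo (suc n)))

F1111 : ℕ → ℕ
F1111 n = sumSizes n (λ m p → length (filter (valid1111? n) (allMatrices m p)))

F1011 : ℕ → ℕ
F1011 n = sumSizes n (λ m p → length (filter (valid1011? n) (allMatrices m p)))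

-- Little-o for ℕ-valued sequences: for every ε = 1/(k+1) > 0, eventually f n ≤ ε g n.
_IsLittleO_ : (ℕ → ℕ) → (ℕ → ℕ) → Set
f IsLittleO g = ∀ (k : ℕ) → ∃ λ N → ∀ n → N N.≤ n → suc k N.* f n N.≤ g n

{-# OPTIONS --safe #-}
module Submission where

-- Call a row single if it has exactly one 1, and let σ = εn for a small ε > 0.
-- Matrices with fewer than σ single rows are rare even without forbidding equal
-- rows: any of the at least n − σ ones lying in the other rows can be moved into
-- a new row placed just above its own, and this is undone by choosing a single
-- row (there are now at most σ + 1) and merging it into the next one.  If there
-- are at least σ single rows, overwrite one of them by another, in σ² ways; as
-- the rows were distinct, the result shows which two rows were involved, and only
-- the O(n) possibilities for the lost 1 remain.  Its column may have become zero
-- and is then deleted.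

open import Defs
open import Data.Bool using (Bool; true; false)
import Data.Bool as B
open import Data.Bool.Properties using (¬-not)
open import Data.Nat using (ℕ; zero; suc; _+_; _*_; _∸_; _≤_; _<_; z≤n; s≤s; _≟_; _≤?_; _/_; _%_; NonZero; >-nonZero)
open import Data.Nat.Properties
open import Data.Nat.DivMod using (m≡m%n+[m/n]*n; m%n<n; m/n*n≤m; /-mono-≤; m*n/n≡m)
open import Data.Nat.ListAction using (sum)
open import Data.Nat.Tactic.RingSolver using (solve-∀)
open import Data.Fin using (Fin; zero; suc; punchIn; punchOut)
open import Data.Fin.Properties as Fin using ()
open import Data.List using (List; []; _∷_; _++_; map; concatMap; length; filter; upTo; allFin; take; cartesianProduct)
open import Data.List.Properties using (length-++; length-map; length-filter; length-take; take-all; length-tabulate; map-upTo; map-applyUpTo)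
open import Data.List.Membership.Propositional using (_∈_; lose; find)
open import Data.List.Membership.Propositional.Properties
open import Data.List.Relation.Unary.All using (All; []; _∷_)
import Data.List.Relation.Unary.All as All
open import Data.List.Relation.Unary.Any using (Any; here; there)
open import Data.List.Relation.Unary.AllPairs using ([]; _∷_)
open import Data.List.Relation.Unary.Unique.Propositional using (Unique)
import Data.List.Relation.Unary.Unique.Propositional.Properties as Unique
open import Data.List.Relation.Binary.Subset.Propositional using (_⊆_)
open import Data.Product using (_×_; _,_; proj₁; proj₂; ∃; map₁)
open import Data.Sum using (inj₁; inj₂)
import Data.Vec as Vec
open import Data.Vec using (Vec; []; _∷_; lookup; _[_]≔_; toList; transpose; replicate; insertAt; removeAt)
open import Data.Vec.Properties using (lookup∘update; lookup∘update′; []≔-idempotent; []≔-lookup; lookup-replicate; lookup-⊛; lookup-map; insertAt-punchIn; insertAt-removeAt; insertAt-lookup; ∷-injectiveʳ; ≡-dec)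
open import Function using (_∘_; id; case_of_)
open import Relation.Nullary using (¬_; Dec; yes; no; ¬?; contradiction)
open import Relation.Nullary.Decidable using (_×-dec_)
open import Relation.Unary using (Decidable)
open import Relation.Binary.PropositionalEquality using (_≡_; _≢_; refl; sym; trans; cong; cong₂; subst; module ≡-Reasoning)

private
  variable
    A C : Set
    k m p : ℕ

-- Counting with duplicate-free lists.

⊆-length : ∀ {xs ys : List A} → Unique xs → xs ⊆ ys → length xs ≤ length ys
⊆-length {xs = []} _ _ = z≤n
⊆-length {xs = x ∷ xs} (x∉ ∷ u) sub with ∈-∃++ (sub (here refl))
... | ys , zs , refl = begin
    suc (length xs)               ≤⟨ s≤s (⊆-length u sub′) ⟩
    suc (length (ys ++ zs))       ≡⟨ cong suc (length-++ ys) ⟩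
    suc (length ys + length zs)   ≡⟨ +-suc (length ys) (length zs) ⟨
    length ys + suc (length zs)   ≡⟨ length-++ ys ⟨
    length (ys ++ x ∷ zs)         ∎
  where
  open ≤-Reasoning
  -- Deleting one occurrence of `x` from the larger list loses no element of `xs`, because `x` does
  -- not recur there.
  sub′ : xs ⊆ ys ++ zs
  sub′ z∈ with ∈-++⁻ ys (sub (there z∈))
  ... | inj₁ z∈ys = ∈-++⁺ˡ z∈ys
  ... | inj₂ (here refl) = contradiction refl (All.lookup x∉ z∈)
  ... | inj₂ (there z∈zs) = ∈-++⁺ʳ ys z∈zs

∈-concatMap : ∀ (f : A → List C) {x xs y} → x ∈ xs → y ∈ f x → y ∈ concatMap f xs
∈-concatMap f x∈ y∈ = ∈-concatMap⁺ f (lose x∈ y∈)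

concatMap-∈ : ∀ (f : A → List C) xs {y} → y ∈ concatMap f xs → ∃ λ x → x ∈ xs × y ∈ f x
concatMap-∈ f xs y∈ = find (∈-concatMap⁻ f {xs = xs} y∈)

Unique-concatMap : ∀ (f : A → List C) {xs} → Unique xs → (∀ x → Unique (f x)) →
  (∀ {x y z} → z ∈ f x → z ∈ f y → x ≡ y) → Unique (concatMap f xs)
Unique-concatMap f [] _ _ = []
Unique-concatMap f {x ∷ xs} (x∉ ∷ u) uf disj =
  Unique.++⁺ (uf x) (Unique-concatMap f u uf disj) λ (z∈x , z∈xs) →
    case concatMap-∈ f xs z∈xs of λ (y , y∈ , z∈y) → All.lookup x∉ y∈ (disj z∈x z∈y)

length-concatMap-≤ : ∀ (f : A → List C) xs {b} → (∀ {x} → x ∈ xs → length (f x) ≤ b) →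
  length (concatMap f xs) ≤ b * length xs
length-concatMap-≤ f [] {b} _ = z≤n
length-concatMap-≤ f (x ∷ xs) {b} h = begin
  length (f x ++ concatMap f xs)         ≡⟨ length-++ (f x) ⟩
  length (f x) + length (concatMap f xs) ≤⟨ +-mono-≤ (h (here refl)) (length-concatMap-≤ f xs (h ∘ there)) ⟩
  b + b * length xs                      ≡⟨ *-suc b (length xs) ⟨
  b * suc (length xs)                    ∎
  where open ≤-Reasoning

length-concatMap-≥ : ∀ (f : A → List C) xs {a} → (∀ {x} → x ∈ xs → a ≤ length (f x)) →
  a * length xs ≤ length (concatMap f xs)
length-concatMap-≥ f [] {a} _ = ≤-reflexive (*-zeroʳ a)
length-concatMap-≥ f (x ∷ xs) {a} h = begin
  a * suc (length xs)                    ≡⟨ *-suc a (length xs) ⟩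
  a + a * length xs                      ≤⟨ +-mono-≤ (h (here refl)) (length-concatMap-≥ f xs (h ∘ there)) ⟩
  length (f x) + length (concatMap f xs) ≡⟨ length-++ (f x) ⟨
  length (f x ++ concatMap f xs)         ∎
  where open ≤-Reasoning

length-filter-¬ : ∀ {P : A → Set} (P? : Decidable P) xs →
  length xs ≡ length (filter P? xs) + length (filter (¬? ∘ P?) xs)
length-filter-¬ P? [] = refl
length-filter-¬ P? (x ∷ xs) with P? x
... | yes _ = cong suc (length-filter-¬ P? xs)
... | no _ = trans (cong suc (length-filter-¬ P? xs)) (sym (+-suc _ _))

tagged : (A → List C) → List A → List (A × C)
tagged g = concatMap (λ x → map (x ,_) (g x))

∈-tagged⁻ : ∀ (g : A → List C) xs {x c} → (x , c) ∈ tagged g xs → x ∈ xs × c ∈ g x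
∈-tagged⁻ g xs e with concatMap-∈ (λ x → map (x ,_) (g x)) xs e
... | x , x∈ , e′ with ∈-map⁻ (x ,_) e′
... | _ , c∈ , refl = x∈ , c∈

Unique-tagged : ∀ (g : A → List C) {xs} → Unique xs → (∀ x → Unique (g x)) → Unique (tagged g xs)
Unique-tagged g u ug = Unique-concatMap _ u (λ x → Unique.map⁺ (λ { refl → refl }) (ug x)) disj
  where
  disj : ∀ {x y z} → z ∈ map (x ,_) (g x) → z ∈ map (y ,_) (g y) → x ≡ y
  disj {x} {y} a b with ∈-map⁻ (x ,_) a | ∈-map⁻ (y ,_) b
  ... | _ , _ , refl | _ , _ , refl = refl

-- The form in which both injections are counted. Each pair of an object and a choice has to appear
-- in the output `T` of a decoder, which may contain repetitions and junk. An upper bound for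
-- `length T` then plays the role of the bound on fibres.
tagged-count : ∀ (g : A → List C) {xs T a} → Unique xs → (∀ x → Unique (g x)) →
  (∀ {x} → x ∈ xs → a ≤ length (g x)) →
  (∀ {x c} → x ∈ xs → c ∈ g x → (x , c) ∈ T) → a * length xs ≤ length T
tagged-count g {xs} u ug lower dec = ≤-trans
  (length-concatMap-≥ _ xs λ {x} x∈ → ≤-trans (lower x∈) (≤-reflexive (sym (length-map (x ,_) (g x)))))
  (⊆-length (Unique-tagged g u ug) λ e → case ∈-tagged⁻ g xs e of λ (x∈ , c∈) → dec x∈ c∈)

-- Completeness and uniqueness of the enumerations.

∈-allVecs : (v : Vec Bool k) → v ∈ allVecs k
∈-allVecs [] = here refl
∈-allVecs (false ∷ v) = ∈-concatMap _ (∈-allVecs v) (here refl)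
∈-allVecs (true ∷ v) = ∈-concatMap _ (∈-allVecs v) (there (here refl))

∈-allMatrices : (M : Matrix m p) → M ∈ allMatrices m p
∈-allMatrices [] = here refl
∈-allMatrices (r ∷ M) = ∈-concatMap _ (∈-allVecs r) (∈-map⁺ (r ∷_) (∈-allMatrices M))

Unique-allVecs : ∀ k → Unique (allVecs k)
Unique-allVecs zero = [] ∷ []
Unique-allVecs (suc k) = Unique-concatMap _ (Unique-allVecs k)
  (λ v → ((λ ()) ∷ []) ∷ [] ∷ [])
  (λ where
    (here refl) (here refl) → refl
    (there (here refl)) (there (here refl)) → refl
    (here refl) (there (here ()))
    (there (here refl)) (here ()))

Unique-allMatrices : ∀ m p → Unique (allMatrices m p)
Unique-allMatrices zero p = [] ∷ []
Unique-allMatrices (suc m) p = Unique-concatMap _ (Unique-allVecs p)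
  (λ r → Unique.map⁺ ∷-injectiveʳ (Unique-allMatrices m p)) disj
  where
  disj : ∀ {r s M} → M ∈ map (r ∷_) (allMatrices m p) → M ∈ map (s ∷_) (allMatrices m p) → r ≡ s
  disj {r} {s} a b with ∈-map⁻ (r ∷_) a | ∈-map⁻ (s ∷_) b
  ... | _ , _ , refl | _ , _ , refl = refl

-- Entries, transposition and validity.

entry : Matrix m p → Fin m → Fin p → Bool
entry M i j = lookup (lookup M i) j

lookup-transpose-∷ : (r : Vec Bool p) (M : Matrix m p) (j : Fin p) →
  lookup (transpose (r ∷ M)) j ≡ lookup r j ∷ lookup (transpose M) j
lookup-transpose-∷ {p} {m} r M j = begin
  lookup (transpose (r ∷ M)) j
    ≡⟨ lookup-⊛ j (replicate p cons Vec.⊛ r) (transpose M) ⟩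
  lookup (replicate p cons Vec.⊛ r) j (lookup (transpose M) j)
    ≡⟨ cong (λ f → f (lookup (transpose M) j)) (lookup-⊛ j (replicate p cons) r) ⟩
  lookup (replicate p cons) j (lookup r j) (lookup (transpose M) j)
    ≡⟨ cong (λ f → f (lookup r j) (lookup (transpose M) j)) (lookup-replicate j cons) ⟩
  lookup r j ∷ lookup (transpose M) j
    ∎
  where
  open ≡-Reasoning
  cons : Bool → Vec Bool m → Vec Bool (suc m)
  cons = _∷_

lookup-transpose : (M : Matrix m p) (i : Fin m) (j : Fin p) → lookup (lookup (transpose M) j) i ≡ entry M i j
lookup-transpose (r ∷ M) zero j = cong (λ v → lookup v zero) (lookup-transpose-∷ r M j)
lookup-transpose (r ∷ M) (suc i) j = trans (cong (λ v → lookup v (suc i)) (lookup-transpose-∷ r M j)) (lookup-transpose M i j)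

module _ {P : A → Set} where
  All-lookup : (v : Vec A k) → All P (toList v) → ∀ i → P (lookup v i)
  All-lookup (x ∷ v) (px ∷ _) zero = px
  All-lookup (x ∷ v) (_ ∷ pv) (suc i) = All-lookup v pv i

  lookup-All : (v : Vec A k) → (∀ i → P (lookup v i)) → All P (toList v)
  lookup-All [] h = []
  lookup-All (x ∷ v) h = h zero ∷ lookup-All v (h ∘ suc)

  Any-lookup : (v : Vec A k) → Any P (toList v) → ∃ λ i → P (lookup v i)
  Any-lookup (x ∷ v) (here px) = zero , px
  Any-lookup (x ∷ v) (there e) = case Any-lookup v e of λ (i , q) → suc i , q

  lookup-Any : (v : Vec A k) (i : Fin k) → P (lookup v i) → Any P (toList v)
  lookup-Any (x ∷ v) zero q = here q
  lookup-Any (x ∷ v) (suc i) q = there (lookup-Any v i q)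

Unique-lookup : (v : Vec A k) → Unique (toList v) → ∀ i j → lookup v i ≡ lookup v j → i ≡ j
Unique-lookup (x ∷ v) u zero zero e = refl
Unique-lookup (x ∷ v) (x∉ ∷ _) zero (suc j) e = contradiction e (All-lookup v x∉ j)
Unique-lookup (x ∷ v) (x∉ ∷ _) (suc i) zero e = contradiction (sym e) (All-lookup v x∉ i)
Unique-lookup (x ∷ v) (_ ∷ u) (suc i) (suc j) e = cong suc (Unique-lookup v u i j e)

-- An entrywise form of the two conditions: row operations preserve it by moving an explicit
-- witness, and the transpose disappears from view.
RowsNonZero ColsNonZero : Matrix m p → Set
RowsNonZero M = ∀ i → ∃ λ j → entry M i j ≡ true
ColsNonZero M = ∀ j → ∃ λ i → entry M i j ≡ true

Valid⇒RowsNonZero : ∀ {n} (M : Matrix m p) → Valid1111 n M → RowsNonZero M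
Valid⇒RowsNonZero M (_ , rows , _) i = Any-lookup (lookup M i) (All-lookup M rows i)

Valid⇒ColsNonZero : ∀ {n} (M : Matrix m p) → Valid1111 n M → ColsNonZero M
Valid⇒ColsNonZero M (_ , _ , cols) j with Any-lookup (lookup (transpose M) j) (All-lookup (transpose M) cols j)
... | i , e = i , trans (sym (lookup-transpose M i j)) e

mkValid : ∀ {n} (M : Matrix m p) → ones M ≡ n → RowsNonZero M → ColsNonZero M → Valid1111 n M
mkValid M eq rows cols = eq
  , lookup-All M (λ i → case rows i of λ (j , e) → lookup-Any (lookup M i) j e)
  , lookup-All (transpose M) (λ j → case cols j of λ (i , e) →
      lookup-Any (lookup (transpose M) j) i (trans (lookup-transpose M i j) e))

-- Unit vectors and the number of ones.

unit : Fin p → Vec Bool p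
unit j = replicate _ false [ j ]≔ true

unit-self : (j : Fin p) → lookup (unit j) j ≡ true
unit-self j = lookup∘update j (replicate _ false) true

unit-true : (j y : Fin p) → lookup (unit j) y ≡ true → y ≡ j
unit-true j y e with y Fin.≟ j
... | yes y≡j = y≡j
... | no y≢j = contradiction
  (trans (sym e) (trans (lookup∘update′ y≢j (replicate _ false) true) (lookup-replicate y false))) λ ()

onesVec-set : (v : Vec Bool p) (j : Fin p) → lookup v j ≡ false → onesVec (v [ j ]≔ true) ≡ suc (onesVec v)
onesVec-set (false ∷ v) zero e = refl
onesVec-set (true ∷ v) (suc j) e = cong suc (onesVec-set v j e)
onesVec-set (false ∷ v) (suc j) e = onesVec-set v j e

onesVec-clear : (v : Vec Bool p) (j : Fin p) → lookup v j ≡ true → suc (onesVec (v [ j ]≔ false)) ≡ onesVec v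
onesVec-clear (true ∷ v) zero e = refl
onesVec-clear (true ∷ v) (suc j) e = cong suc (onesVec-clear v j e)
onesVec-clear (false ∷ v) (suc j) e = onesVec-clear v j e

onesVec-zeros : ∀ p → onesVec (replicate p false) ≡ 0
onesVec-zeros zero = refl
onesVec-zeros (suc p) = onesVec-zeros p

onesVec-unit : (j : Fin p) → onesVec (unit j) ≡ 1
onesVec-unit {p} j = trans (onesVec-set (replicate p false) j (lookup-replicate j false)) (cong suc (onesVec-zeros p))

onesVec≡0⇒zeros : (v : Vec Bool p) → onesVec v ≡ 0 → v ≡ replicate p false
onesVec≡0⇒zeros [] e = refl
onesVec≡0⇒zeros (false ∷ v) e = cong (false ∷_) (onesVec≡0⇒zeros v e)

onesVec≡1⇒unit : (v : Vec Bool p) → onesVec v ≡ 1 → ∃ λ j → v ≡ unit j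
onesVec≡1⇒unit (true ∷ v) e = zero , cong (true ∷_) (onesVec≡0⇒zeros v (suc-injective e))
onesVec≡1⇒unit (false ∷ v) e = case onesVec≡1⇒unit v e of λ (j , q) → suc j , cong (false ∷_) q

onesVec>0⇒true : (v : Vec Bool p) → 0 < onesVec v → ∃ λ j → lookup v j ≡ true
onesVec>0⇒true (true ∷ v) _ = zero , refl
onesVec>0⇒true (false ∷ v) h = case onesVec>0⇒true v h of λ (j , e) → suc j , e

true⇒onesVec>0 : (v : Vec Bool p) (j : Fin p) → lookup v j ≡ true → 0 < onesVec v
true⇒onesVec>0 v j e = ≤-trans (s≤s z≤n) (≤-reflexive (onesVec-clear v j e))

ones-≔ : (M : Matrix m p) (i : Fin m) (r : Vec Bool p) → onesVec (lookup M i) ≡ onesVec r → ones (M [ i ]≔ r) ≡ ones M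
ones-≔ (s ∷ M) zero r e = cong (_+ ones M) (sym e)
ones-≔ (s ∷ M) (suc i) r e = cong (onesVec s +_) (ones-≔ M i r e)

rows≤ones : (M : Matrix m p) → RowsNonZero M → m ≤ ones M
rows≤ones [] _ = z≤n
rows≤ones (r ∷ M) h = +-mono-≤ (true⇒onesVec>0 r _ (proj₂ (h zero))) (rows≤ones M (h ∘ suc))

-- Positions of ones, single rows, and ones outside single rows.

cells : Vec Bool p → List (Fin p)
cells [] = []
cells (true ∷ v) = zero ∷ map Fin.suc (cells v)
cells (false ∷ v) = map Fin.suc (cells v)

length-cells : (v : Vec Bool p) → length (cells v) ≡ onesVec v
length-cells [] = refl
length-cells (true ∷ v) = cong suc (trans (length-map Fin.suc (cells v)) (length-cells v))
length-cells (false ∷ v) = trans (length-map Fin.suc (cells v)) (length-cells v)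

∈-cells⁺ : (v : Vec Bool p) (j : Fin p) → lookup v j ≡ true → j ∈ cells v
∈-cells⁺ (true ∷ v) zero e = here refl
∈-cells⁺ (true ∷ v) (suc j) e = there (∈-map⁺ Fin.suc (∈-cells⁺ v j e))
∈-cells⁺ (false ∷ v) (suc j) e = ∈-map⁺ Fin.suc (∈-cells⁺ v j e)

∈-cells⁻ : (v : Vec Bool p) {j : Fin p} → j ∈ cells v → lookup v j ≡ true
∈-cells⁻ (true ∷ v) (here refl) = refl
∈-cells⁻ (true ∷ v) (there e) with ∈-map⁻ Fin.suc e
... | _ , e′ , refl = ∈-cells⁻ v e′
∈-cells⁻ (false ∷ v) e with ∈-map⁻ Fin.suc e
... | _ , e′ , refl = ∈-cells⁻ v e′

zero∉map-suc : (xs : List (Fin k)) → All (zero ≢_) (map Fin.suc xs)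
zero∉map-suc [] = []
zero∉map-suc (x ∷ xs) = (λ ()) ∷ zero∉map-suc xs

Unique-cells : (v : Vec Bool p) → Unique (cells v)
Unique-cells [] = []
Unique-cells (true ∷ v) = zero∉map-suc (cells v) ∷ Unique.map⁺ Fin.suc-injective (Unique-cells v)
Unique-cells (false ∷ v) = Unique.map⁺ Fin.suc-injective (Unique-cells v)

singleRows : Matrix m p → List (Fin m)
singleRows [] = []
singleRows (r ∷ M) with onesVec r ≟ 1
... | yes _ = zero ∷ map Fin.suc (singleRows M)
... | no _ = map Fin.suc (singleRows M)

singles : Matrix m p → ℕ
singles M = length (singleRows M)

∈-singleRows⁻ : (M : Matrix m p) {i : Fin m} → i ∈ singleRows M → onesVec (lookup M i) ≡ 1
∈-singleRows⁻ (r ∷ M) e with onesVec r ≟ 1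
∈-singleRows⁻ (r ∷ M) (here refl) | yes q = q
∈-singleRows⁻ (r ∷ M) (there e) | yes _ with ∈-map⁻ Fin.suc e
... | _ , e′ , refl = ∈-singleRows⁻ M e′
∈-singleRows⁻ (r ∷ M) e | no _ with ∈-map⁻ Fin.suc e
... | _ , e′ , refl = ∈-singleRows⁻ M e′

Unique-singleRows : (M : Matrix m p) → Unique (singleRows M)
Unique-singleRows [] = []
Unique-singleRows (r ∷ M) with onesVec r ≟ 1
... | yes _ = zero∉map-suc (singleRows M) ∷ Unique.map⁺ Fin.suc-injective (Unique-singleRows M)
... | no _ = Unique.map⁺ Fin.suc-injective (Unique-singleRows M)

singles-∷-≤ : (r : Vec Bool p) (M : Matrix m p) → singles (r ∷ M) ≤ suc (singles M)
singles-∷-≤ r M with onesVec r ≟ 1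
... | yes _ = ≤-reflexive (cong suc (length-map Fin.suc (singleRows M)))
... | no _ = m≤n⇒m≤1+n (≤-reflexive (length-map Fin.suc (singleRows M)))

singles-∷-≥ : (r : Vec Bool p) (M : Matrix m p) → singles M ≤ singles (r ∷ M)
singles-∷-≥ r M with onesVec r ≟ 1
... | yes _ = m≤n⇒m≤1+n (≤-reflexive (sym (length-map Fin.suc (singleRows M))))
... | no _ = ≤-reflexive (sym (length-map Fin.suc (singleRows M)))

sucFst : Fin m × A → Fin (suc m) × A
sucFst = map₁ suc

sucFst-injective : ∀ {x y : Fin m × A} → sucFst x ≡ sucFst y → x ≡ y
sucFst-injective {x = _ , _} {_ , _} refl = refl

-- The ones that may be moved into a new row. A zero row has no cells, so every row that contributes
-- here has at least two ones and stays nonzero after losing one.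
multiCells : Matrix m p → List (Fin m × Fin p)
multiCells [] = []
multiCells (r ∷ M) with onesVec r ≟ 1
... | yes _ = map sucFst (multiCells M)
... | no _ = map (zero ,_) (cells r) ++ map sucFst (multiCells M)

∈-multiCells⁻ : (M : Matrix m p) {i : Fin m} {j : Fin p} → (i , j) ∈ multiCells M →
  onesVec (lookup M i) ≢ 1 × entry M i j ≡ true
∈-multiCells⁻ (r ∷ M) e with onesVec r ≟ 1
∈-multiCells⁻ (r ∷ M) e | yes _ with ∈-map⁻ sucFst e
... | (_ , _) , e′ , refl = ∈-multiCells⁻ M e′
∈-multiCells⁻ (r ∷ M) e | no ne with ∈-++⁻ (map (zero ,_) (cells r)) e
... | inj₁ e₁ with ∈-map⁻ (zero ,_) e₁
...   | _ , e′ , refl = ne , ∈-cells⁻ r e′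
∈-multiCells⁻ (r ∷ M) e | no ne | inj₂ e₂ with ∈-map⁻ sucFst e₂
...   | (_ , _) , e′ , refl = ∈-multiCells⁻ M e′

Unique-multiCells : (M : Matrix m p) → Unique (multiCells M)
Unique-multiCells [] = []
Unique-multiCells (r ∷ M) with onesVec r ≟ 1
... | yes _ = Unique.map⁺ sucFst-injective (Unique-multiCells M)
... | no _ = Unique.++⁺ (Unique.map⁺ (λ { refl → refl }) (Unique-cells r))
  (Unique.map⁺ sucFst-injective (Unique-multiCells M)) disj
  where
  disj : ∀ {z} → ¬ (z ∈ map (zero ,_) (cells r) × z ∈ map sucFst (multiCells M))
  disj (a , b) with ∈-map⁻ (zero ,_) a | ∈-map⁻ sucFst b
  ... | _ , _ , refl | _ , _ , ()

-- A single row contributes exactly its only one to the left side. Hence few single rows mean many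
-- movable ones.
singles+multiCells : (M : Matrix m p) → singles M + length (multiCells M) ≡ ones M
singles+multiCells [] = refl
singles+multiCells (r ∷ M) with onesVec r ≟ 1
... | yes q = begin
  suc (length (map Fin.suc (singleRows M))) + length (map sucFst (multiCells M)) ≡⟨ cong₂ (λ x y → suc x + y) (length-map Fin.suc (singleRows M)) (length-map sucFst (multiCells M)) ⟩
  1 + (singles M + length (multiCells M)) ≡⟨ cong₂ _+_ (sym q) (singles+multiCells M) ⟩
  onesVec r + ones M ∎
  where open ≡-Reasoning
... | no _ = begin
  length (map Fin.suc (singleRows M)) + length (map (zero ,_) (cells r) ++ map sucFst (multiCells M))
    ≡⟨ cong₂ _+_ (length-map Fin.suc (singleRows M)) (length-++ (map (zero ,_) (cells r))) ⟩
  singles M + (length (map (zero ,_) (cells r)) + length (map sucFst (multiCells M)))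
    ≡⟨ cong₂ (λ x y → singles M + (x + y)) (trans (length-map (zero ,_) (cells r)) (length-cells r)) (length-map sucFst (multiCells M)) ⟩
  singles M + (onesVec r + length (multiCells M)) ≡⟨ x+[y+z]≡y+[x+z] (singles M) (onesVec r) (length (multiCells M)) ⟩
  onesVec r + (singles M + length (multiCells M)) ≡⟨ cong (onesVec r +_) (singles+multiCells M) ⟩
  onesVec r + ones M ∎
  where
  open ≡-Reasoning
  x+[y+z]≡y+[x+z] : ∀ x y z → x + (y + z) ≡ y + (x + z)
  x+[y+z]≡y+[x+z] = solve-∀

-- Moving a one into a new row, and undoing it.

split : Matrix m p → Fin m → Fin p → Matrix (suc m) p
split (r ∷ M) zero j = unit j ∷ (r [ j ]≔ false) ∷ M
split (r ∷ M) (suc i) j = r ∷ split M i j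

-- Since `split` puts the new row directly above its origin, the index `i` locates both rows. The
-- column of the one to be returned is supplied as `j`, which makes the operation total.
merge : Matrix (suc m) p → Fin m → Fin p → Matrix m p
merge (u ∷ r ∷ M) zero j = (r [ j ]≔ true) ∷ M
merge (u ∷ r ∷ M) (suc i) j = u ∷ merge (r ∷ M) i j

merge-split : (M : Matrix m p) (i : Fin m) (j : Fin p) → entry M i j ≡ true → merge (split M i j) i j ≡ M
merge-split (r ∷ M) zero j e = cong (_∷ M)
  (trans ([]≔-idempotent r j) (trans (cong (r [ j ]≔_) (sym e)) ([]≔-lookup r j)))
-- `merge` looks at two rows, and the first row of the inner split is exposed only once its index is
-- known; hence the extra case distinction.
merge-split (r ∷ s ∷ M) (suc zero) j e = cong (r ∷_) (merge-split (s ∷ M) zero j e)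
merge-split (r ∷ s ∷ M) (suc (suc i)) j e = cong (r ∷_) (merge-split (s ∷ M) (suc i) j e)

ones-split : (M : Matrix m p) (i : Fin m) (j : Fin p) → entry M i j ≡ true → ones (split M i j) ≡ ones M
ones-split (r ∷ M) zero j e rewrite onesVec-unit j = cong (_+ ones M) (onesVec-clear r j e)
ones-split (r ∷ M) (suc i) j e = cong (onesVec r +_) (ones-split M i j e)

map-suc-≤ : ∀ (xs : List (Fin k)) (ys : List (Fin m)) a → length xs ≤ a + length ys →
  length (map Fin.suc xs) ≤ a + length (map Fin.suc ys)
map-suc-≤ xs ys a h rewrite length-map Fin.suc xs | length-map Fin.suc ys = h

-- At most two rows become single: the new one, and the old one in case it had two ones.
singles-split : (M : Matrix m p) (i : Fin m) (j : Fin p) → singles (split M i j) ≤ 2 + singles M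
singles-split (r ∷ M) zero j = begin
  singles (unit j ∷ (r [ j ]≔ false) ∷ M) ≤⟨ singles-∷-≤ (unit j) _ ⟩
  suc (singles ((r [ j ]≔ false) ∷ M))    ≤⟨ s≤s (singles-∷-≤ (r [ j ]≔ false) M) ⟩
  2 + singles M                           ≤⟨ s≤s (s≤s (singles-∷-≥ r M)) ⟩
  2 + singles (r ∷ M)                     ∎
  where open ≤-Reasoning
singles-split (r ∷ M) (suc i) j with onesVec r ≟ 1
... | yes _ = s≤s (map-suc-≤ (singleRows (split M i j)) (singleRows M) 2 (singles-split M i j))
... | no _ = map-suc-≤ (singleRows (split M i j)) (singleRows M) 2 (singles-split M i j)

split-rows : (M : Matrix m p) (i : Fin m) (j : Fin p) → onesVec (lookup M i) ≢ 1 → entry M i j ≡ true →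
  RowsNonZero M → RowsNonZero (split M i j)
split-rows (r ∷ M) zero j ne e h zero = j , unit-self j
-- If clearing `j` left no one behind, the row would have been single.
split-rows (r ∷ M) zero j ne e h (suc zero) = onesVec>0⇒true (r [ j ]≔ false)
  (n≢0⇒n>0 λ z → ne (trans (sym (onesVec-clear r j e)) (cong suc z)))
split-rows (r ∷ M) zero j ne e h (suc (suc x)) = h (suc x)
split-rows (r ∷ M) (suc i) j ne e h zero = h zero
split-rows (r ∷ M) (suc i) j ne e h (suc x) = split-rows M i j ne e (h ∘ suc) x

-- A witness for column `y` stays in its row, unless it is the moved one, which is then found in the
-- new row.
split-cols : (M : Matrix m p) (i : Fin m) (j : Fin p) {y : Fin p} →
  (∃ λ x → entry M x y ≡ true) → ∃ λ x → entry (split M i j) x y ≡ true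
split-cols (r ∷ M) zero j {y} (zero , q) with y Fin.≟ j
... | yes refl = zero , unit-self y
... | no y≢j = suc zero , trans (lookup∘update′ y≢j r false) q
split-cols (r ∷ M) zero j (suc x , q) = suc (suc x) , q
split-cols (r ∷ M) (suc i) j (zero , q) = zero , q
split-cols (r ∷ M) (suc i) j (suc x , q) = case split-cols M i j (x , q) of λ (x′ , q′) → suc x′ , q′

-- The sites at which a given matrix can have been split, as far as the matrix itself shows: the new
-- row is single and is never the last row.
splitSites : Matrix (suc m) p → List (Fin m × Fin p)
splitSites {zero} _ = []
splitSites {suc m} (u ∷ M) with onesVec u ≟ 1
... | yes _ = map (zero ,_) (cells u) ++ map sucFst (splitSites M)
... | no _ = map sucFst (splitSites M)

-- A single row has one cell, so it offers one site.
length-splitSites : (M : Matrix (suc m) p) → length (splitSites M) ≤ singles M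
length-splitSites {zero} _ = z≤n
length-splitSites {suc m} (u ∷ M) with onesVec u ≟ 1
... | yes q = begin
  length (map (zero ,_) (cells u) ++ map sucFst (splitSites M)) ≡⟨ length-++ (map (zero ,_) (cells u)) ⟩
  length (map (zero ,_) (cells u)) + length (map sucFst (splitSites M))
    ≡⟨ cong₂ _+_ (trans (length-map (zero ,_) (cells u)) (trans (length-cells u) q)) (length-map sucFst (splitSites M)) ⟩
  suc (length (splitSites M)) ≤⟨ s≤s (length-splitSites M) ⟩
  suc (singles M) ≡⟨ cong suc (length-map Fin.suc (singleRows M)) ⟨
  suc (length (map Fin.suc (singleRows M))) ∎
  where open ≤-Reasoning
... | no _ = begin
  length (map sucFst (splitSites M)) ≡⟨ length-map sucFst (splitSites M) ⟩
  length (splitSites M)              ≤⟨ length-splitSites M ⟩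
  singles M                          ≡⟨ length-map Fin.suc (singleRows M) ⟨
  length (map Fin.suc (singleRows M))    ∎
  where open ≤-Reasoning

-- The inserted row is `unit j`, hence single with its cell at `j`.
∈-splitSites : (M : Matrix m p) (i : Fin m) (j : Fin p) → (i , j) ∈ splitSites (split M i j)
∈-splitSites (r ∷ M) zero j with onesVec (unit j) ≟ 1
... | yes _ = ∈-++⁺ˡ (∈-map⁺ (zero ,_) (∈-cells⁺ (unit j) j (unit-self j)))
... | no ne = contradiction (onesVec-unit j) ne
∈-splitSites (r ∷ M) (suc i) j with onesVec r ≟ 1
... | yes _ = ∈-++⁺ʳ (map (zero ,_) (cells r)) (∈-map⁺ sucFst (∈-splitSites M i j))
... | no _ = ∈-map⁺ sucFst (∈-splitSites M i j)

-- Matrices with few single rows.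

matrices1111 matrices1011 : (n m p : ℕ) → List (Matrix m p)
matrices1111 n m p = filter (valid1111? n) (allMatrices m p)
matrices1011 n m p = filter (valid1011? n) (allMatrices m p)

∈-matrices1111⁺ : ∀ {n} {M : Matrix m p} → Valid1111 n M → M ∈ matrices1111 n m p
∈-matrices1111⁺ {n = n} {M} = ∈-filter⁺ (valid1111? n) (∈-allMatrices M)

∈-matrices1111⁻ : ∀ {n} {M : Matrix m p} → M ∈ matrices1111 n m p → Valid1111 n M
∈-matrices1111⁻ {m} {p} {n} e = proj₂ (∈-filter⁻ (valid1111? n) {xs = allMatrices m p} e)

∈-matrices1011⁻ : ∀ {n} {M : Matrix m p} → M ∈ matrices1011 n m p → Valid1011 n M
∈-matrices1011⁻ {m} {p} {n} e = proj₂ (∈-filter⁻ (valid1011? n) {xs = allMatrices m p} e)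

Unique-matrices1011 : ∀ n m p → Unique (matrices1011 n m p)
Unique-matrices1011 n m p = Unique.filter⁺ (valid1011? n) (Unique-allMatrices m p)

few? : ∀ σ (M : Matrix m p) → Dec (singles M < σ)
few? σ M = suc (singles M) ≤? σ

few many : (σ n m p : ℕ) → ℕ
few σ n m p = length (filter (few? σ) (matrices1011 n m p))
many σ n m p = length (filter (¬? ∘ few? σ) (matrices1011 n m p))

few+many : ∀ σ n m p → length (matrices1011 n m p) ≡ few σ n m p + many σ n m p
few+many σ n m p = length-filter-¬ (few? σ) (matrices1011 n m p)

split-valid : ∀ {n} (M : Matrix m p) i j → Valid1111 n M → onesVec (lookup M i) ≢ 1 → entry M i j ≡ true →
  Valid1111 n (split M i j)
split-valid M i j v ne e = mkValid (split M i j)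
  (trans (ones-split M i j e) (proj₁ v))
  (split-rows M i j ne e (Valid⇒RowsNonZero M v))
  (λ y → split-cols M i j (Valid⇒ColsNonZero M v y))

-- The left side counts pairs of a matrix and a movable one. The new row may equal an old one, so
-- the images are counted by `matrices1111`, one row taller.
few-count : ∀ σ n m p → (n ∸ σ) * few σ n m p ≤ suc σ * length (matrices1111 n (suc m) p)
few-count σ n m p = begin
  (n ∸ σ) * few σ n m p ≤⟨ tagged-count multiCells (Unique.filter⁺ (few? σ) (Unique-matrices1011 n m p)) Unique-multiCells lower decodes ⟩
  length T              ≤⟨ length-concatMap-≤ decode Y upper ⟩
  suc σ * length Y      ≤⟨ *-monoʳ-≤ (suc σ) (length-filter (λ M → singles M ≤? suc σ) (matrices1111 n (suc m) p)) ⟩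
  suc σ * length (matrices1111 n (suc m) p) ∎
  where
  open ≤-Reasoning
  X : List (Matrix m p)
  X = filter (few? σ) (matrices1011 n m p)
  Y : List (Matrix (suc m) p)
  Y = filter (λ M → singles M ≤? suc σ) (matrices1111 n (suc m) p)
  decode : Matrix (suc m) p → List (Matrix m p × (Fin m × Fin p))
  decode M = map (λ c → merge M (proj₁ c) (proj₂ c) , c) (splitSites M)
  T : List (Matrix m p × (Fin m × Fin p))
  T = concatMap decode Y
  X⁻ : ∀ {M} → M ∈ X → Valid1111 n M × singles M < σ
  X⁻ M∈ = case ∈-filter⁻ (few? σ) {xs = matrices1011 n m p} M∈ of λ (M∈′ , h) → proj₁ (∈-matrices1011⁻ M∈′) , h
  lower : ∀ {M} → M ∈ X → n ∸ σ ≤ length (multiCells M)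
  lower {M} M∈ with X⁻ M∈
  ... | (refl , _) , h = begin
    ones M ∸ σ         ≤⟨ ∸-monoʳ-≤ (ones M) (<⇒≤ h) ⟩
    ones M ∸ singles M ≡⟨ cong (_∸ singles M) (singles+multiCells M) ⟨
    singles M + length (multiCells M) ∸ singles M ≡⟨ m+n∸m≡n (singles M) _ ⟩
    length (multiCells M) ∎
  upper : ∀ {M} → M ∈ Y → length (decode M) ≤ suc σ
  upper {M} M∈ = begin
    length (decode M)     ≡⟨ length-map _ (splitSites M) ⟩
    length (splitSites M) ≤⟨ length-splitSites M ⟩
    singles M             ≤⟨ proj₂ (∈-filter⁻ (λ M → singles M ≤? suc σ) {xs = matrices1111 n (suc m) p} M∈) ⟩
    suc σ                 ∎
  decodes : ∀ {M c} → M ∈ X → c ∈ multiCells M → (M , c) ∈ T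
  decodes {M} {i , j} M∈ c∈ with X⁻ M∈ | ∈-multiCells⁻ M c∈
  ... | v , h | ne , e = ∈-concatMap decode
    -- Fewer than `σ` single rows, plus two, is at most `suc σ`.
    (∈-filter⁺ (λ M → singles M ≤? suc σ) (∈-matrices1111⁺ (split-valid M i j v ne e))
      (≤-trans (singles-split M i j) (s≤s h)))
    (subst (λ M′ → (M′ , (i , j)) ∈ decode (split M i j)) (merge-split M i j e)
      (∈-map⁺ (λ c → merge (split M i j) (proj₁ c) (proj₂ c) , c) (∈-splitSites M i j)))

-- Pairs of rows and pairs of equal rows.

length-cartesianProduct : (xs : List A) (ys : List C) → length (cartesianProduct xs ys) ≡ length xs * length ys
length-cartesianProduct [] ys = refl
length-cartesianProduct (x ∷ xs) ys = trans (length-++ (map (x ,_) ys))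
  (cong₂ _+_ (length-map (x ,_) ys) (length-cartesianProduct xs ys))

equalPair? : (M : Matrix m p) (c : Fin m × Fin m) →
  Dec (proj₁ c ≢ proj₂ c × lookup M (proj₁ c) ≡ lookup M (proj₂ c))
equalPair? M (i , i′) = ¬? (i Fin.≟ i′) ×-dec ≡-dec B._≟_ (lookup M i) (lookup M i′)

allEqualPairs : Matrix m p → List (Fin m × Fin m)
allEqualPairs M = filter (equalPair? M) (cartesianProduct (allFin _) (allFin _))

-- Truncated so that its length is at most 2 for every matrix; nothing is lost
-- when there is just one unordered pair of equal rows.
equalPairs : Matrix m p → List (Fin m × Fin m)
equalPairs M = take 2 (allEqualPairs M)

length-equalPairs : (M : Matrix m p) → length (equalPairs M) ≤ 2
length-equalPairs M = ≤-trans (≤-reflexive (length-take 2 (allEqualPairs M))) (m⊓n≤m 2 (length (allEqualPairs M)))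

∈-equalPairs : (M : Matrix m p) {i i′ : Fin m} → i ≢ i′ → lookup M i ≡ lookup M i′ →
  (∀ {x y} → x ≢ y → lookup M x ≡ lookup M y → (x , y) ∈ (i , i′) ∷ (i′ , i) ∷ []) →
  (i , i′) ∈ equalPairs M
-- The full list is duplicate-free and contained in a list of two pairs, so `take 2` leaves it
-- unchanged.
∈-equalPairs {m} M {i} {i′} i≢i′ e only = subst ((i , i′) ∈_) (sym (take-all 2 (allEqualPairs M) ≤2))
  (∈-filter⁺ (equalPair? M) (∈-cartesianProduct⁺ (∈-allFin i) (∈-allFin i′)) (i≢i′ , e))
  where
  only′ : allEqualPairs M ⊆ (i , i′) ∷ (i′ , i) ∷ []
  only′ z = case proj₂ (∈-filter⁻ (equalPair? M) {xs = cartesianProduct (allFin m) (allFin m)} z) of λ (x≢y , q) → only x≢y q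
  ≤2 : length (allEqualPairs M) ≤ 2
  ≤2 = ⊆-length (Unique.filter⁺ (equalPair? M) (Unique.cartesianProduct⁺ (Unique.allFin⁺ m) (Unique.allFin⁺ m))) only′

-- Inserting and deleting a zero column.

addZeroCol : Fin (suc p) → Matrix m p → Matrix m (suc p)
addZeroCol k = Vec.map (λ r → insertAt r k false)

onesVec-insert-false : (v : Vec Bool p) (k : Fin (suc p)) → onesVec (insertAt v k false) ≡ onesVec v
onesVec-insert-false v zero = refl
onesVec-insert-false (true ∷ v) (suc k) = cong suc (onesVec-insert-false v k)
onesVec-insert-false (false ∷ v) (suc k) = onesVec-insert-false v k

ones-addZeroCol : (k : Fin (suc p)) (M : Matrix m p) → ones (addZeroCol k M) ≡ ones M
ones-addZeroCol k [] = refl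
ones-addZeroCol k (r ∷ M) = cong₂ _+_ (onesVec-insert-false r k) (ones-addZeroCol k M)

-- Deletion is expressed through insertion because the decoder works by inserting: matching on the
-- equation brings the matrix into the form the decoder produces.
dropZeroCol : (M : Matrix m (suc p)) (k : Fin (suc p)) → (∀ i → entry M i k ≡ false) → ∃ λ N → M ≡ addZeroCol k N
dropZeroCol [] k h = [] , refl
dropZeroCol (r ∷ M) k h with dropZeroCol M k (h ∘ suc)
... | N , e = removeAt r k ∷ N , cong₂ _∷_
  (trans (sym (insertAt-removeAt r k)) (cong (insertAt (removeAt r k) k) (h zero))) e

entry-addZeroCol : (k : Fin (suc p)) (M : Matrix m p) (i : Fin m) (j : Fin p) →
  entry (addZeroCol k M) i (punchIn k j) ≡ entry M i j
entry-addZeroCol k M i j = trans (cong (λ r → lookup r (punchIn k j)) (lookup-map i _ M)) (insertAt-punchIn (lookup M i) k false j)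

-- The one of a row cannot lie in the zero column `k`, so it survives at the index given by
-- `punchOut`. The columns of `N` are the columns other than `k`, reached by `punchIn`.
dropZeroCol-valid : ∀ {n} (k : Fin (suc p)) (N : Matrix m p) → ones (addZeroCol k N) ≡ n →
  RowsNonZero (addZeroCol k N) → (∀ y → y ≢ k → ∃ λ i → entry (addZeroCol k N) i y ≡ true) → Valid1111 n N
dropZeroCol-valid k N eq rows cols = mkValid N (trans (sym (ones-addZeroCol k N)) eq) rows′
  (λ j → case cols (punchIn k j) (Fin.punchInᵢ≢i k j) of λ (i , e) → i , trans (sym (entry-addZeroCol k N i j)) e)
  where
  rows′ : RowsNonZero N
  rows′ i with rows i
  ... | y , e with k Fin.≟ y
  ...   | yes refl = contradiction (trans (sym e)
    (trans (cong (λ r → lookup r k) (lookup-map i _ N)) (insertAt-lookup (lookup N i) k false))) λ ()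
  ...   | no k≢y = punchOut k≢y , trans (sym (entry-addZeroCol k N i (punchOut k≢y)))
    (trans (cong (entry (addZeroCol k N) i) (Fin.punchIn-punchOut k≢y)) e)

-- Overwriting one single row by another.

module CopyRow {n} (M : Matrix m p) (v : Valid1011 n M) {i i′ : Fin m} (i≢i′ : i ≢ i′) {j j′ : Fin p}
  (ri : lookup M i ≡ unit j) (ri′ : lookup M i′ ≡ unit j′) where

  copied : Matrix m p
  copied = M [ i′ ]≔ lookup M i

  distinct : ∀ x y → lookup M x ≡ lookup M y → x ≡ y
  distinct = Unique-lookup M (proj₂ v)

  copied-i′ : lookup copied i′ ≡ lookup M i
  copied-i′ = lookup∘update i′ M (lookup M i)

  copied-other : ∀ {x} → x ≢ i′ → lookup copied x ≡ lookup M x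
  copied-other x≢i′ = lookup∘update′ x≢i′ M (lookup M i)

  -- The overwritten row was `unit j′`, so `i′` and `j′` suffice to undo the copying.
  restore : copied [ i′ ]≔ unit j′ ≡ M
  restore = trans ([]≔-idempotent M i′) (trans (cong (M [ i′ ]≔_) (sym ri′)) ([]≔-lookup M i′))

  ones-copied : ones copied ≡ n
  ones-copied = trans (ones-≔ M i′ (lookup M i)
    (trans (cong onesVec ri′) (trans (onesVec-unit j′) (sym (trans (cong onesVec ri) (onesVec-unit j))))))
    (proj₁ (proj₁ v))

  rows-copied : RowsNonZero copied
  rows-copied x with x Fin.≟ i′
  ... | yes refl = j , trans (cong (λ r → lookup r j) (trans copied-i′ ri)) (unit-self j)
  ... | no x≢i′ = case Valid⇒RowsNonZero M (proj₁ v) x of λ (y , e) →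
    y , trans (cong (λ r → lookup r y) (copied-other x≢i′)) e

  -- Only row `i′` changed and its only one was in column `j′`, so a witness for any other column
  -- lies in an unchanged row.
  cols-copied : ∀ y → y ≢ j′ → ∃ λ x → entry copied x y ≡ true
  cols-copied y y≢j′ with Valid⇒ColsNonZero M (proj₁ v) y
  ... | x , e = x , trans (cong (λ r → lookup r y) (copied-other x≢i′)) e
    where
    x≢i′ : x ≢ i′
    x≢i′ refl = y≢j′ (unit-true j′ y (trans (cong (λ r → lookup r y) (sym ri′)) e))

  -- This is where distinctness of the rows enters: away from `i′` the rows are still those of `M`,
  -- and row `i′` now repeats row `i` and hence no other old row.
  only-pair : ∀ {x y} → x ≢ y → lookup copied x ≡ lookup copied y → (x , y) ∈ (i , i′) ∷ (i′ , i) ∷ []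
  only-pair {x} {y} x≢y e with x Fin.≟ i′ | y Fin.≟ i′
  ... | yes refl | yes refl = contradiction refl x≢y
  ... | yes refl | no y≢ = there (here (cong (i′ ,_)
    (sym (distinct i y (trans (sym copied-i′) (trans e (copied-other y≢)))))))
  ... | no x≢ | yes refl = here (cong (_, i′)
    (distinct x i (trans (sym (copied-other x≢)) (trans e copied-i′))))
  ... | no x≢ | no y≢ = contradiction (distinct x y (trans (sym (copied-other x≢)) (trans e (copied-other y≢)))) x≢y

  pair∈ : (i , i′) ∈ equalPairs copied
  pair∈ = ∈-equalPairs copied i≢i′ (trans (copied-other i≢i′) (sym copied-i′)) only-pair

-- Matrices with many single rows.

matrices1111-narrower : (n m p : ℕ) → ℕ
matrices1111-narrower n m zero = 0
matrices1111-narrower n m (suc p) = length (matrices1111 n m p)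

-- The decoder for a guessed column `j` of the lost one. An equal pair does not show which of its
-- rows was overwritten, so both orders are tried.
restoreRow : Matrix m p → Fin p → List (Matrix m p × (Fin m × Fin m))
restoreRow M j = map (λ c → M [ proj₂ c ]≔ unit j , c) (equalPairs M)

length-restoreRow : (M : Matrix m p) (j : Fin p) → length (restoreRow M j) ≤ 2
length-restoreRow M j = ≤-trans (≤-reflexive (length-map _ (equalPairs M))) (length-equalPairs M)

-- Pairs `(i , i′)` of single rows fall into three cases. For `i = i′` the matrix is left alone,
-- which keeps the number of choices at `σ * σ`; otherwise the column of the lost one either is
-- still nonzero or has to be deleted. These two decoders serve the first two cases.
decodeDiagonal decodeSame : Matrix m p → List (Matrix m p × (Fin m × Fin m))
decodeDiagonal M = map (λ i → M , (i , i)) (allFin _)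
decodeSame M = concatMap (restoreRow M) (allFin _)

-- The deleted column is the column of the lost one, so the single guess `k` serves both for
-- reinserting the column and for restoring the row.
decodeNarrower : Matrix m p → List (Matrix m (suc p) × (Fin m × Fin m))
decodeNarrower M = concatMap (λ k → restoreRow (addZeroCol k M) k) (allFin _)

decodeAllNarrower : (n m p : ℕ) → List (Matrix m p × (Fin m × Fin m))
decodeAllNarrower n m zero = []
decodeAllNarrower n m (suc p) = concatMap decodeNarrower (matrices1111 n m p)

length-decodeAllNarrower : ∀ n m p → length (decodeAllNarrower n m p) ≤ 2 * p * matrices1111-narrower n m p
length-decodeAllNarrower n m zero = z≤n
length-decodeAllNarrower n m (suc p) = length-concatMap-≤ decodeNarrower (matrices1111 n m p) λ {M} _ → ≤-trans
  (length-concatMap-≤ (λ k → restoreRow (addZeroCol k M) k) (allFin (suc p)) λ {k} _ → length-restoreRow (addZeroCol k M) k)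
  (≤-reflexive (cong (2 *_) (length-tabulate {n = suc p} id)))

-- Stated for a variable `M′` in place of the copied matrix, so that the equation from `dropZeroCol`
-- can be matched with `refl`.
decodes-narrower : ∀ {n} (M M′ : Matrix m p) (j : Fin p) c → M′ [ proj₂ c ]≔ unit j ≡ M → c ∈ equalPairs M′ →
  ones M′ ≡ n → RowsNonZero M′ → (∀ y → y ≢ j → ∃ λ x → entry M′ x y ≡ true) → (∀ x → entry M′ x j ≡ false) →
  (M , c) ∈ decodeAllNarrower n m p
decodes-narrower {p = suc p} M M′ j c restore c∈ eq rows cols z with dropZeroCol M′ j z
... | N , refl = ∈-concatMap decodeNarrower (∈-matrices1111⁺ (dropZeroCol-valid j N eq rows cols))
  (∈-concatMap (λ k → restoreRow (addZeroCol k N) k) (∈-allFin j)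
    (subst (λ M → (M , c) ∈ restoreRow (addZeroCol j N) j) restore (∈-map⁺ _ c∈)))

-- A matrix of the same size is decoded in `m` ways on the diagonal and in at most `2 * p` ways off
-- it (order of the pair, column). A narrower one is decoded in at most `2 * p` ways.
many-count : ∀ σ n m p → σ * σ * many σ n m p ≤
  (m + 2 * p) * length (matrices1111 n m p) + 2 * p * matrices1111-narrower n m p
many-count σ n m p = begin
  σ * σ * many σ n m p
    ≤⟨ tagged-count rowPairs (Unique.filter⁺ (¬? ∘ few? σ) (Unique-matrices1011 n m p)) Unique-rowPairs lower decodes ⟩
  length (D ++ S ++ N)
    ≡⟨ trans (length-++ D) (cong (length D +_) (length-++ S)) ⟩
  length D + (length S + length N)
    ≤⟨ +-mono-≤ (length-concatMap-≤ decodeDiagonal Y λ _ → ≤-reflexive (trans (length-map _ (allFin m)) (length-tabulate {n = m} id)))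
        (+-mono-≤ (length-concatMap-≤ decodeSame Y λ {M} _ → ≤-trans
            (length-concatMap-≤ (restoreRow M) (allFin p) λ {j} _ → length-restoreRow M j)
            (≤-reflexive (cong (2 *_) (length-tabulate {n = p} id))))
          (length-decodeAllNarrower n m p)) ⟩
  m * length Y + (2 * p * length Y + 2 * p * matrices1111-narrower n m p)
    ≡⟨ +-assoc (m * length Y) _ _ ⟨
  m * length Y + 2 * p * length Y + 2 * p * matrices1111-narrower n m p
    ≡⟨ cong (_+ 2 * p * matrices1111-narrower n m p) (*-distribʳ-+ (length Y) m (2 * p)) ⟨
  (m + 2 * p) * length Y + 2 * p * matrices1111-narrower n m p ∎
  where
  open ≤-Reasoning
  X Y : List (Matrix m p)
  X = filter (¬? ∘ few? σ) (matrices1011 n m p)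
  Y = matrices1111 n m p
  D S N : List (Matrix m p × (Fin m × Fin m))
  D = concatMap decodeDiagonal Y
  S = concatMap decodeSame Y
  N = decodeAllNarrower n m p
  rowPairs : Matrix m p → List (Fin m × Fin m)
  rowPairs M = cartesianProduct (singleRows M) (singleRows M)
  Unique-rowPairs : ∀ M → Unique (rowPairs M)
  Unique-rowPairs M = Unique.cartesianProduct⁺ (Unique-singleRows M) (Unique-singleRows M)
  X⁻ : ∀ {M} → M ∈ X → Valid1011 n M × σ ≤ singles M
  X⁻ M∈ = case ∈-filter⁻ (¬? ∘ few? σ) {xs = matrices1011 n m p} M∈ of λ (M∈′ , h) → ∈-matrices1011⁻ M∈′ , ≮⇒≥ h
  lower : ∀ {M} → M ∈ X → σ * σ ≤ length (rowPairs M)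
  lower {M} M∈ = ≤-trans (*-mono-≤ (proj₂ (X⁻ M∈)) (proj₂ (X⁻ M∈)))
    (≤-reflexive (sym (length-cartesianProduct (singleRows M) (singleRows M))))
  decodes : ∀ {M c} → M ∈ X → c ∈ rowPairs M → (M , c) ∈ D ++ S ++ N
  decodes {M} {i , i′} M∈ c∈ with i Fin.≟ i′
  ... | yes refl = ∈-++⁺ˡ (∈-concatMap decodeDiagonal (∈-matrices1111⁺ (proj₁ (proj₁ (X⁻ M∈))))
    (∈-map⁺ (λ i → M , (i , i)) (∈-allFin i)))
  ... | no i≢i′ with ∈-cartesianProduct⁻ (singleRows M) (singleRows M) c∈
  ... | i∈ , i′∈ with onesVec≡1⇒unit (lookup M i) (∈-singleRows⁻ M i∈) | onesVec≡1⇒unit (lookup M i′) (∈-singleRows⁻ M i′∈)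
  -- The decoder depends on whether column `j′` still contains a one after the copying.
  ... | j , ri | j′ , ri′ = ∈-++⁺ʳ D (case Fin.any? (λ x → entry copied x j′ B.≟ true) of λ where
      (yes col) → ∈-++⁺ˡ (∈-concatMap decodeSame
        (∈-matrices1111⁺ (mkValid copied ones-copied rows-copied (allCols col)))
        (∈-concatMap (restoreRow copied) (∈-allFin j′)
          (subst (λ M → (M , (i , i′)) ∈ restoreRow copied j′) restore (∈-map⁺ (λ c → copied [ proj₂ c ]≔ unit j′ , c) pair∈))))
      (no none) → ∈-++⁺ʳ S (decodes-narrower M copied j′ (i , i′) restore pair∈ ones-copied rows-copied cols-copied
        λ x → ¬-not λ e → none (x , e)))
    where
    open CopyRow M (proj₁ (X⁻ M∈)) i≢i′ ri ri′
    allCols : (∃ λ x → entry copied x j′ ≡ true) → ColsNonZero copied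
    allCols col y with y Fin.≟ j′
    ... | yes refl = col
    ... | no y≢j′ = cols-copied y y≢j′

-- Sums over all sizes.

Σ< : ℕ → (ℕ → ℕ) → ℕ
Σ< n g = sum (map g (upTo n))

Σ<-suc : ∀ n g → Σ< (suc n) g ≡ g 0 + Σ< n (g ∘ suc)
Σ<-suc n g = cong (λ xs → g 0 + sum xs) (trans (map-applyUpTo suc g n) (sym (map-upTo (g ∘ suc) n)))

Σ<-last : ∀ n g → Σ< (suc n) g ≡ Σ< n g + g n
Σ<-last zero g = +-comm (g 0) 0
Σ<-last (suc n) g = begin
  Σ< (2 + n) g                       ≡⟨ Σ<-suc (suc n) g ⟩
  g 0 + Σ< (suc n) (g ∘ suc)         ≡⟨ cong (g 0 +_) (Σ<-last n (g ∘ suc)) ⟩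
  g 0 + (Σ< n (g ∘ suc) + g (suc n)) ≡⟨ +-assoc (g 0) _ _ ⟨
  g 0 + Σ< n (g ∘ suc) + g (suc n)   ≡⟨ cong (_+ g (suc n)) (Σ<-suc n g) ⟨
  Σ< (suc n) g + g (suc n)           ∎
  where open ≡-Reasoning

Σ<-mono : ∀ n {g h} → (∀ i → i < n → g i ≤ h i) → Σ< n g ≤ Σ< n h
Σ<-mono zero _ = z≤n
Σ<-mono (suc n) {g} {h} le rewrite Σ<-suc n g | Σ<-suc n h =
  +-mono-≤ (le 0 (s≤s z≤n)) (Σ<-mono n λ i i<n → le (suc i) (s≤s i<n))

Σ<-cong : ∀ n {g h} → (∀ i → g i ≡ h i) → Σ< n g ≡ Σ< n h
Σ<-cong n eq = ≤-antisym (Σ<-mono n λ i _ → ≤-reflexive (eq i)) (Σ<-mono n λ i _ → ≤-reflexive (sym (eq i)))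

Σ<-+ : ∀ n g h → Σ< n (λ i → g i + h i) ≡ Σ< n g + Σ< n h
Σ<-+ zero g h = refl
Σ<-+ (suc n) g h rewrite Σ<-suc n g | Σ<-suc n h | Σ<-suc n (λ i → g i + h i) | Σ<-+ n (g ∘ suc) (h ∘ suc) =
  interchange (g 0) (h 0) (Σ< n (g ∘ suc)) (Σ< n (h ∘ suc))
  where
  interchange : ∀ a b c d → a + b + (c + d) ≡ a + c + (b + d)
  interchange = solve-∀

Σ<-* : ∀ n c g → Σ< n (λ i → c * g i) ≡ c * Σ< n g
Σ<-* zero c g = sym (*-zeroʳ c)
Σ<-* (suc n) c g rewrite Σ<-suc n g | Σ<-suc n (λ i → c * g i) | Σ<-* n c (g ∘ suc) =
  sym (*-distribˡ-+ c (g 0) _)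

sumSizes-mono : ∀ n {f g} → (∀ m p → m ≤ n → p ≤ n → f m p ≤ g m p) → sumSizes n f ≤ sumSizes n g
sumSizes-mono n le = Σ<-mono (suc n) λ { m (s≤s m≤n) → Σ<-mono (suc n) λ { p (s≤s p≤n) → le m p m≤n p≤n } }

sumSizes-+ : ∀ n f g → sumSizes n (λ m p → f m p + g m p) ≡ sumSizes n f + sumSizes n g
sumSizes-+ n f g = trans (Σ<-cong (suc n) λ m → Σ<-+ (suc n) (f m) (g m))
  (Σ<-+ (suc n) (λ m → Σ< (suc n) (f m)) (λ m → Σ< (suc n) (g m)))

sumSizes-* : ∀ n c f → sumSizes n (λ m p → c * f m p) ≡ c * sumSizes n f
sumSizes-* n c f = trans (Σ<-cong (suc n) λ m → Σ<-* (suc n) c (f m)) (Σ<-* (suc n) c (λ m → Σ< (suc n) (f m)))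

matrices1111-tooTall : ∀ n p → length (matrices1111 n (suc n) p) ≡ 0
matrices1111-tooTall n p with matrices1111 n (suc n) p in eq
... | [] = refl
... | M ∷ _ with ∈-matrices1111⁻ {M = M} (subst (M ∈_) (sym eq) (here refl))
...   | v = contradiction (subst (suc n ≤_) (proj₁ v) (rows≤ones M (Valid⇒RowsNonZero M v))) 1+n≰n

-- Shifting the number of rows by one drops the term for 0 rows and adds the term for `suc n` rows,
-- which vanishes by `matrices1111-tooTall`.
taller-sum : ∀ n → sumSizes n (λ m p → length (matrices1111 n (suc m) p)) ≤ F1111 n
taller-sum n = begin
  Σ< (suc n) (G ∘ suc)         ≤⟨ m≤n+m _ (G 0) ⟩
  G 0 + Σ< (suc n) (G ∘ suc)   ≡⟨ Σ<-suc (suc n) G ⟨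
  Σ< (2 + n) G                 ≡⟨ Σ<-last (suc n) G ⟩
  F1111 n + G (suc n)          ≡⟨ cong (F1111 n +_) G-top ⟩
  F1111 n + 0                  ≡⟨ +-identityʳ _ ⟩
  F1111 n                      ∎
  where
  open ≤-Reasoning
  G : ℕ → ℕ
  G m = Σ< (suc n) (λ p → length (matrices1111 n m p))
  G-top : G (suc n) ≡ 0
  -- The sum of zeros is read as 0 times a sum.
  G-top = trans (Σ<-cong (suc n) (matrices1111-tooTall n)) (Σ<-* (suc n) 0 (λ _ → 0))

-- An index shift in the width: the term at width 0 is 0 by convention, and the right side has the
-- additional term at width `n`.
narrower-sum : ∀ n → sumSizes n (matrices1111-narrower n) ≤ F1111 n
narrower-sum n = Σ<-mono (suc n) λ m _ → begin
  Σ< (suc n) (matrices1111-narrower n m)                              ≡⟨ Σ<-suc n (matrices1111-narrower n m) ⟩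
  Σ< n (λ p → length (matrices1111 n m p))                            ≤⟨ m≤m+n _ _ ⟩
  Σ< n (λ p → length (matrices1111 n m p)) + length (matrices1111 n m n) ≡⟨ Σ<-last n (λ p → length (matrices1111 n m p)) ⟨
  Σ< (suc n) (λ p → length (matrices1111 n m p))                      ∎
  where open ≤-Reasoning

-- Summed bounds and choice of the threshold.

few-sum : ∀ σ n → (n ∸ σ) * sumSizes n (few σ n) ≤ suc σ * F1111 n
few-sum σ n = begin
  (n ∸ σ) * sumSizes n (few σ n)            ≡⟨ sumSizes-* n (n ∸ σ) (few σ n) ⟨
  sumSizes n (λ m p → (n ∸ σ) * few σ n m p) ≤⟨ sumSizes-mono n (λ m p _ _ → few-count σ n m p) ⟩
  sumSizes n (λ m p → suc σ * length (matrices1111 n (suc m) p)) ≡⟨ sumSizes-* n (suc σ) (λ m p → length (matrices1111 n (suc m) p)) ⟩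
  suc σ * sumSizes n (λ m p → length (matrices1111 n (suc m) p)) ≤⟨ *-monoʳ-≤ (suc σ) (taller-sum n) ⟩
  suc σ * F1111 n                           ∎
  where open ≤-Reasoning

-- With `m` and `p` at most `n`, matrices of the same size contribute `3n` and narrower ones `2n`,
-- which gives the factor 5.
many-sum : ∀ σ n → σ * σ * sumSizes n (many σ n) ≤ 5 * n * F1111 n
many-sum σ n = begin
  σ * σ * sumSizes n (many σ n)             ≡⟨ sumSizes-* n (σ * σ) (many σ n) ⟨
  sumSizes n (λ m p → σ * σ * many σ n m p) ≤⟨ sumSizes-mono n (λ m p m≤n p≤n → ≤-trans (many-count σ n m p)
      (+-mono-≤ (*-monoˡ-≤ (f m p) (+-mono-≤ m≤n (*-monoʳ-≤ 2 p≤n))) (*-monoˡ-≤ (g m p) (*-monoʳ-≤ 2 p≤n)))) ⟩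
  sumSizes n (λ m p → (n + 2 * n) * f m p + 2 * n * g m p)
    ≡⟨ sumSizes-+ n (λ m p → (n + 2 * n) * f m p) (λ m p → 2 * n * g m p) ⟩
  sumSizes n (λ m p → (n + 2 * n) * f m p) + sumSizes n (λ m p → 2 * n * g m p)
    ≡⟨ cong₂ _+_ (sumSizes-* n (n + 2 * n) f) (sumSizes-* n (2 * n) g) ⟩
  (n + 2 * n) * F1111 n + 2 * n * sumSizes n g ≤⟨ +-monoʳ-≤ _ (*-monoʳ-≤ (2 * n) (narrower-sum n)) ⟩
  (n + 2 * n) * F1111 n + 2 * n * F1111 n   ≡⟨ collect n (F1111 n) ⟩
  5 * n * F1111 n                           ∎
  where
  open ≤-Reasoning
  f g : ℕ → ℕ → ℕ
  f m p = length (matrices1111 n m p)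
  g = matrices1111-narrower n
  collect : ∀ n x → (n + 2 * n) * x + 2 * n * x ≡ 5 * n * x
  collect = solve-∀

F1011-few-many : ∀ σ n → F1011 n ≡ sumSizes n (few σ n) + sumSizes n (many σ n)
F1011-few-many σ n = trans (Σ<-cong (suc n) λ m → Σ<-cong (suc n) λ p → few+many σ n m p) (sumSizes-+ n (few σ n) (many σ n))

-- With K = k + 1 and threshold σ = ⌊n / 8K⌋, both parts are at most F1111 n / 2K once σ ≥ 160K².
theorem5 : F1011 IsLittleO F1111
theorem5 k = N , bound
  where
  open ≤-Reasoning
  K d N : ℕ
  K = suc k
  d = 8 * K
  N = 160 * (K * K) * d

  bound : ∀ n → N ≤ n → K * F1011 n ≤ F1111 n
  -- The inequality is doubled so that each of the two parts can be charged one full `F1111 n`.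
  bound n N≤n = *-cancelˡ-≤ 2 (begin
    2 * (K * F1011 n)         ≡⟨ cong (λ x → 2 * (K * x)) (F1011-few-many σ n) ⟩
    2 * (K * (Few + Many))    ≡⟨ distribute K Few Many ⟩
    2 * K * Few + 2 * K * Many ≤⟨ +-mono-≤ few-bound many-bound ⟩
    F1111 n + F1111 n         ≡⟨ cong (F1111 n +_) (+-identityʳ (F1111 n)) ⟨
    2 * F1111 n               ∎)
    where
    σ Few Many : ℕ
    σ = n / d
    Few = sumSizes n (few σ n)
    Many = sumSizes n (many σ n)

    distribute : ∀ K Few Many → 2 * (K * (Few + Many)) ≡ 2 * K * Few + 2 * K * Many
    distribute = solve-∀

    160K²≤σ : 160 * (K * K) ≤ σ
    160K²≤σ = ≤-trans (≤-reflexive (sym (m*n/n≡m (160 * (K * K)) d))) (/-mono-≤ {o = d} {p = d} N≤n ≤-refl)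

    1≤σ : 1 ≤ σ
    1≤σ = ≤-trans (s≤s z≤n) 160K²≤σ

    n≤[1+σ]d : n ≤ suc σ * d
    n≤[1+σ]d = begin
      n               ≡⟨ m≡m%n+[m/n]*n n d ⟩
      n % d + σ * d   ≤⟨ +-monoˡ-≤ (σ * d) (<⇒≤ (m%n<n n d)) ⟩
      suc σ * d       ∎

    1+σ≤2σ : suc σ ≤ 2 * σ
    1+σ≤2σ = ≤-trans (+-monoˡ-≤ σ 1≤σ) (≤-reflexive (cong (σ +_) (sym (+-identityʳ σ))))

    few-gain : 2 * K * suc σ ≤ n ∸ σ
    -- The factor 8 in `d` comes from here: `2K(σ+1)` is at most `4Kσ`, and another `4Kσ` covers the
    -- subtracted `σ`.
    few-gain = ≤-trans (≤-reflexive (sym (m+n∸n≡m (2 * K * suc σ) σ))) (∸-monoˡ-≤ σ (begin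
      2 * K * suc σ + σ           ≤⟨ +-mono-≤ (*-monoʳ-≤ (2 * K) 1+σ≤2σ) (m≤n*m σ (4 * K)) ⟩
      2 * K * (2 * σ) + 4 * K * σ ≡⟨ eq K σ ⟩
      σ * d                       ≤⟨ m/n*n≤m n d ⟩
      n                           ∎))
      where
      eq : ∀ K σ → 2 * K * (2 * σ) + 4 * K * σ ≡ σ * (8 * K)
      eq = solve-∀

    few-bound : 2 * K * Few ≤ F1111 n
    few-bound = *-cancelˡ-≤ (suc σ) (begin
      suc σ * (2 * K * Few) ≡⟨ eq (suc σ) (2 * K) Few ⟩
      2 * K * suc σ * Few   ≤⟨ *-monoˡ-≤ Few few-gain ⟩
      (n ∸ σ) * Few         ≤⟨ few-sum σ n ⟩
      suc σ * F1111 n     ∎)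
      where
      eq : ∀ a b c → a * (b * c) ≡ b * a * c
      eq = solve-∀

    many-gain : 5 * n * (2 * K) ≤ σ * σ
    many-gain = begin
      -- Here `n` is at most `2σd = 16Kσ`, whence the constant `160 = 5 * 16 * 2`. The lower bound
      -- on `σ` then turns `160K²σ` into `σ * σ`.
      5 * n * (2 * K)               ≤⟨ *-monoˡ-≤ (2 * K) (*-monoʳ-≤ 5 (≤-trans n≤[1+σ]d (*-monoˡ-≤ d 1+σ≤2σ))) ⟩
      5 * (2 * σ * d) * (2 * K)     ≡⟨ eq K σ ⟩
      160 * (K * K) * σ             ≤⟨ *-monoˡ-≤ σ 160K²≤σ ⟩
      σ * σ                         ∎
      where
      eq : ∀ K σ → 5 * (2 * σ * (8 * K)) * (2 * K) ≡ 160 * (K * K) * σ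
      eq = solve-∀

    5n≢0 : NonZero (5 * n)
    -- `N` is positive, so `n` is too, and `5 * n` can be cancelled.
    5n≢0 = m*n≢0 5 n {{_}} {{>-nonZero (≤-trans (s≤s z≤n) N≤n)}}

    many-bound : 2 * K * Many ≤ F1111 n
    many-bound = *-cancelˡ-≤ (5 * n) {{5n≢0}} (begin
      5 * n * (2 * K * Many) ≡⟨ *-assoc (5 * n) (2 * K) Many ⟨
      5 * n * (2 * K) * Many ≤⟨ *-monoˡ-≤ Many many-gain ⟩
      σ * σ * Many           ≤⟨ many-sum σ n ⟩
      5 * n * F1111 n     ∎)
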